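{- For every partial computable function $\psi:\omega\to\{0,1\}$, the group $\mathcal H/\mathcal R$ (defined from $\psi$ as in the context) has a computable presentation.
   Context: Let $(p_i)_{i\in\omega}$, $(q_i)_{i\in\omega}$, $(r_i)_{i\in\omega}$ be three sequences of primes which together partition the set of odd primes (each odd prime occurs exactly once among them). Let $\psi$ be a partial computable function with values in $\{0,1\}$; write $\psi_{\text{at } t}(i)=e$ to mean that the computation of $\psi(i)$ converges exactly at stage $t$ (and not before) with value $e$. Let $\mathcal H$ be the free abelian group, written additively, on generators $\alpha_i,\beta_i,\gamma_i$ ($i\in\omega$). Let $\mathcal R$ be the set of relations $\{\mathcal R_{i,t} : \psi(i)\text{ converges exactly at stage } t\}$, where $\mathcal R_{i,t}$ is the relation $p_i^t\alpha_i=q_i^t\beta_i$ if $\psi_{\text{at }t}(i)=0$ and $p_i^t\alpha_i=-q_i^t\beta_i$ if $\psi_{\text{at }t}(i)=1$; $\mathcal H/\mathcal R$ is the quotient of $\mathcal H$ by the subgroup generated by these relations. A computable presentation of a group is an isomorphic group with domain $\omega$ whose operation is a computable function. -}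

module Defs where

open import Data.Nat as ℕ using (ℕ; zero; suc; _^_)
open import Data.Nat.Primality using (Prime)
open import Data.Nat.Properties using () renaming (_≟_ to _≟ℕ_)
open import Data.Integer as ℤ using (ℤ; +_; 0ℤ; 1ℤ)
open import Data.Bool using (Bool; true; false)
open import Data.Maybe using (Maybe; just; nothing)
open import Data.List using (List; []; _∷_; _++_; map)
open import Data.Product using (Σ; ∃; _×_; _,_; proj₁; proj₂)
open import Data.Sum using (_⊎_)
open import Data.Fin using (Fin)
open import Relation.Nullary using (yes; no; ¬_)
open import Relation.Binary.PropositionalEquality using (_≡_)

-- Partial computable functions ω ⇀ {0,1}, given by their stage-wise
-- approximations: ψs s i = just e means ψ(i) has converged by stage s
-- with value e (false = 0, true = 1).  Computability is synthetic:
-- Agda functions are the computable ones.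

Stages : Set
Stages = ℕ → ℕ → Maybe Bool

Monotone : Stages → Set
Monotone ψs = ∀ s i e → ψs s i ≡ just e → ψs (suc s) i ≡ just e

ConvAt : Stages → ℕ → ℕ → Bool → Set
ConvAt ψs i zero    e = ψs zero i ≡ just e
ConvAt ψs i (suc t) e = (ψs (suc t) i ≡ just e) × (ψs t i ≡ nothing)

Odd : ℕ → Set
Odd n = ∃ λ k → n ≡ suc (2 ℕ.* k)

seq3 : (p q r : ℕ → ℕ) → Fin 3 → ℕ → ℕ
seq3 p q r Fin.zero i = p i
seq3 p q r (Fin.suc Fin.zero) i = q i
seq3 p q r (Fin.suc (Fin.suc Fin.zero)) i = r i

record OddPrimePartition (p q r : ℕ → ℕ) : Set where
  field
    prime      : ∀ k i → Prime (seq3 p q r k i)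
    odd        : ∀ k i → Odd (seq3 p q r k i)
    injective  : ∀ k i k′ j → seq3 p q r k i ≡ seq3 p q r k′ j → (k ≡ k′) × (i ≡ j)
    covering   : ∀ n → Prime n → Odd n → ∃ λ k → ∃ λ i → seq3 p q r k i ≡ n

-- The free abelian group 𝓗 on generators α_i, β_i, γ_i.
-- Elements are formal finite sums  Σ c·g  (lists of coefficient/generator
-- pairs); two formal sums denote the same element of 𝓗 iff they have the
-- same coefficient at every generator.

data Gen : Set where
  α β γ : ℕ → Gen

δ : Gen → Gen → ℤ
δ (α i) (α j) with i ≟ℕ j
... | yes _ = 1ℤ
... | no  _ = 0ℤ
δ (β i) (β j) with i ≟ℕ j
... | yes _ = 1ℤ
... | no  _ = 0ℤ
δ (γ i) (γ j) with i ≟ℕ j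
... | yes _ = 1ℤ
... | no  _ = 0ℤ
δ _ _ = 0ℤ

H : Set
H = List (ℤ × Gen)

coeff : H → Gen → ℤ
coeff []            g = 0ℤ
coeff ((c , h) ∷ x) g = c ℤ.* δ h g ℤ.+ coeff x g

_+H_ : H → H → H
x +H y = x ++ y

0H : H
0H = []

-H_ : H → H
-H x = map (λ { (c , g) → (ℤ.- c , g) }) x

-- The relations 𝓡_{i,t}, written as relators (elements of 𝓗 which are
-- set to 0):  p_i^t α_i - q_i^t β_i  (value 0)  and  p_i^t α_i + q_i^t β_i
-- (value 1).

relator : (p q : ℕ → ℕ) → ℕ → ℕ → Bool → H
relator p q i t false = (+ (p i ^ t) , α i) ∷ (ℤ.- (+ (q i ^ t)) , β i) ∷ []
relator p q i t true  = (+ (p i ^ t) , α i) ∷ (+ (q i ^ t) , β i) ∷ []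

record RelIx (ψs : Stages) : Set where
  constructor relIx
  field
    i t : ℕ
    e   : Bool
    conv : ConvAt ψs i t e

combo : (p q : ℕ → ℕ) (ψs : Stages) → List (ℤ × RelIx ψs) → H
combo p q ψs []                       = []
combo p q ψs ((c , relIx i t e _) ∷ L) =
  map (λ { (d , g) → (c ℤ.* d , g) }) (relator p q i t e) ++ combo p q ψs L

-- equality in 𝓗/𝓡 :  x - y lies in the subgroup generated by 𝓡
EqHR : (p q : ℕ → ℕ) (ψs : Stages) → H → H → Set
EqHR p q ψs x y = ∃ λ (L : List (ℤ × RelIx ψs)) →
  ∀ g → coeff x g ℤ.- coeff y g ≡ coeff (combo p q ψs L) g

-- A computable presentation of 𝓗/𝓡 : a group with domain ℕ (equality
-- is identity on ℕ) whose operation is an (Agda-)computable function,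
-- together with a group isomorphism onto 𝓗/𝓡.

record ComputablePresentation (p q : ℕ → ℕ) (ψs : Stages) : Set where
  field
    _⊕_   : ℕ → ℕ → ℕ
    h     : ℕ → H
    hom   : ∀ a b → EqHR p q ψs (h (a ⊕ b)) (h a +H h b)
    inj   : ∀ a b → EqHR p q ψs (h a) (h b) → a ≡ b
    surj  : ∀ x → ∃ λ a → EqHR p q ψs (h a) x

module Submission where

-- Computability is synthetic, so we must construct (as Agda
-- functions) a bijection between ℕ and the classes of 𝓗/𝓡.
--
-- Key fact: equality in 𝓗/𝓡 is decidable.  A coefficient function D lies in
-- the subgroup generated by 𝓡 iff D has no γ-part and, for every i, the pair
-- (D(α i), D(β i)) is zero or a multiple of the relator of the unique
-- relation 𝓡_{i,t} (unique since ψ(i) converges at most once).  As p i > 1,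
-- such a stage t is smaller than ∣ D(α i) ∣, so this is a bounded search;
-- finite support leaves finitely many i to check.  Fresh generators γ k give
-- infinitely many classes.  Finally, a decidable equivalence relation with
-- infinitely many classes on an enumerable type has a transversal indexed by
-- ℕ (the least index of each class, in increasing order), along which the
-- group operation is transported.

open import Defs
open import Data.Nat.Base as ℕ using (ℕ; zero; suc; _≤_; _<_; _⊔_; _^_; z≤n; s≤s)
import Data.Nat.Properties as ℕP
open import Data.Nat.Induction using (<-rec)
open import Data.Nat.Primality using (Prime; prime⇒nonTrivial)
open import Data.Integer.Base using (ℤ; +_; -[1+_])
open import Data.Bool.Base using (Bool; true; false)
open import Data.List.Base using (List; []; _∷_; _++_)
open import Data.Product.Base using (Σ; ∃; _×_; _,_; proj₁; proj₂)
open import Data.Sum.Base using (_⊎_; inj₁; inj₂)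
open import Data.Fin.Base using (Fin)
open import Function.Base using (_∘_)
open import Relation.Nullary using (Dec; yes; no; ¬_; contradiction)
open import Relation.Nullary.Decidable using (_×-dec_; _⊎-dec_; ¬?; map′)
import Relation.Unary as U
open import Relation.Binary.Definitions using (Decidable; tri<; tri≈; tri>)
open import Relation.Binary.Structures using (IsEquivalence)
open import Relation.Binary.PropositionalEquality
  using (_≡_; _≢_; refl; sym; trans; cong; subst; module ≡-Reasoning)

Least : (ℕ → Set) → ℕ → Set
Least P m = P m × (∀ {k} → k < m → ¬ P k)

least-witness : {P : ℕ → Set} → U.Decidable P → ∀ {b} → P b → ∃ (Least P)
least-witness {P} P? {b} = <-rec (λ b → P b → ∃ (Least P)) search b
  where
  search : ∀ b → (∀ {c} → c < b → P c → ∃ (Least P)) → P b → ∃ (Least P)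
  search b smaller Pb with ℕP.anyUpTo? P? b
  ... | yes (c , c<b , Pc) = smaller c<b Pc
  ... | no none            = b , Pb , λ k<b Pk → none (_ , k<b , Pk)

∃-Bool? : {Q : Bool → Set} → Dec (Q false) → Dec (Q true) → Dec (Σ Bool Q)
∃-Bool? {Q} Q-false? Q-true? = map′ from-⊎ to-⊎ (Q-false? ⊎-dec Q-true?)
  where
  from-⊎ : Q false ⊎ Q true → Σ Bool Q
  from-⊎ (inj₁ q) = false , q
  from-⊎ (inj₂ q) = true  , q

  to-⊎ : Σ Bool Q → Q false ⊎ Q true
  to-⊎ (false , q) = inj₁ q
  to-⊎ (true  , q) = inj₂ q

module IncreasingEnumeration {P : ℕ → Set} (P? : U.Decidable P)
                             (unbounded : ∀ M → ∃ λ m → M ≤ m × P m) where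

  AtLeast : ℕ → ℕ → Set
  AtLeast M m = M ≤ m × P m

  first : ∀ M → ∃ (Least (AtLeast M))
  first M = least-witness (λ m → (M ℕP.≤? m) ×-dec P? m) (proj₂ (unbounded M))

  nth : ℕ → ℕ
  nth zero    = proj₁ (first 0)
  nth (suc n) = proj₁ (first (suc (nth n)))

  start : ℕ → ℕ
  start zero    = 0
  start (suc n) = suc (nth n)

  nth-least : ∀ n → Least (AtLeast (start n)) (nth n)
  nth-least zero    = proj₂ (first 0)
  nth-least (suc n) = proj₂ (first (suc (nth n)))

  nth-P : ∀ n → P (nth n)
  nth-P n = proj₂ (proj₁ (nth-least n))

  nth-< : ∀ n → nth n < nth (suc n)
  nth-< n = proj₁ (proj₁ (nth-least (suc n)))

  nth-strict : ∀ {a b} → a < b → nth a < nth b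
  nth-strict {a} {suc b} (s≤s a≤b) with ℕP.m≤n⇒m<n∨m≡n a≤b
  ... | inj₁ a<b  = ℕP.<-trans (nth-strict a<b) (nth-< b)
  ... | inj₂ refl = nth-< a

  nth-injective : ∀ {a b} → nth a ≡ nth b → a ≡ b
  nth-injective {a} {b} eq with ℕP.<-cmp a b
  ... | tri< a<b _ _ = contradiction eq (ℕP.<⇒≢ (nth-strict a<b))
  ... | tri≈ _ a≡b _ = a≡b
  ... | tri> _ _ b<a = contradiction (sym eq) (ℕP.<⇒≢ (nth-strict b<a))

  locate : ∀ m → ∃ λ n → start n ≤ m × m ≤ nth n
  locate zero = 0 , z≤n , z≤n
  locate (suc m) with locate m
  ... | n , start≤m , m≤nth with ℕP.m≤n⇒m<n∨m≡n m≤nth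
  ...   | inj₁ m<nth = n , ℕP.m≤n⇒m≤1+n start≤m , m<nth
  ...   | inj₂ refl  = suc n , ℕP.≤-refl , proj₁ (proj₁ (nth-least (suc n)))

  -- within its block, an element of P can only be nth n itself
  nth-onto : ∀ {m} → P m → ∃ λ n → nth n ≡ m
  nth-onto {m} Pm with locate m
  ... | n , start≤m , m≤nth with ℕP.m≤n⇒m<n∨m≡n m≤nth
  ...   | inj₁ m<nth = contradiction (start≤m , Pm) (proj₂ (nth-least n) m<nth)
  ...   | inj₂ m≡nth = n , sym m≡nth

record Enumeration (A : Set) : Set where
  field
    enum       : ℕ → A
    index      : A → ℕ
    enum-index : ∀ x → enum (index x) ≡ x

open Enumeration

module CantorPairing where

  open import Data.Nat.Base using (_+_)

  tri : ℕ → ℕ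
  tri zero    = zero
  tri (suc s) = tri s + suc s

  step : ℕ × ℕ → ℕ × ℕ
  step (zero  , b) = suc b , 0
  step (suc a , b) = a , suc b

  unpair : ℕ → ℕ × ℕ
  unpair zero    = 0 , 0
  unpair (suc n) = step (unpair n)

  pair : ℕ → ℕ → ℕ
  pair a b = tri (a + b) + b

  pair-next-diagonal : ∀ a → pair (suc a) 0 ≡ suc (pair 0 a)
  pair-next-diagonal a = begin
    tri (suc a + 0) + 0 ≡⟨ ℕP.+-identityʳ _ ⟩
    tri (suc a + 0)     ≡⟨ cong tri (ℕP.+-identityʳ (suc a)) ⟩
    tri a + suc a       ≡⟨ ℕP.+-suc (tri a) a ⟩
    suc (pair 0 a)      ∎
    where open ≡-Reasoning

  pair-along-diagonal : ∀ a b → pair a (suc b) ≡ suc (pair (suc a) b)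
  pair-along-diagonal a b = begin
    tri (a + suc b) + suc b   ≡⟨ cong (λ s → tri s + suc b) (ℕP.+-suc a b) ⟩
    tri (suc a + b) + suc b   ≡⟨ ℕP.+-suc (tri (suc a + b)) b ⟩
    suc (pair (suc a) b)      ∎
    where open ≡-Reasoning

  unpair-pair : ∀ a b → unpair (pair a b) ≡ (a , b)
  unpair-pair a b = on-diagonal (a + b) a b refl
    where
    on-diagonal : ∀ s a b → a + b ≡ s → unpair (pair a b) ≡ (a , b)
    on-diagonal s       zero    zero    _  = refl
    on-diagonal (suc s) (suc a) zero    eq = begin
      unpair (pair (suc a) 0)     ≡⟨ cong unpair (pair-next-diagonal a) ⟩
      step (unpair (pair 0 a))    ≡⟨ cong step (on-diagonal s 0 a (ℕP.suc-injective
                                       (trans (cong suc (sym (ℕP.+-identityʳ a))) eq))) ⟩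
      (suc a , 0)                 ∎
      where open ≡-Reasoning
    on-diagonal s       a       (suc b) eq = begin
      unpair (pair a (suc b))     ≡⟨ cong unpair (pair-along-diagonal a b) ⟩
      step (unpair (pair (suc a) b)) ≡⟨ cong step (on-diagonal s (suc a) b
                                          (trans (sym (ℕP.+-suc a b)) eq)) ⟩
      (a , suc b)                 ∎
      where open ≡-Reasoning

  pair-≥ : ∀ a b → b ≤ pair a b
  pair-≥ a b = ℕP.m≤n+m b (tri (a + b))

open CantorPairing using (unpair; pair; unpair-pair; pair-≥)

enum-× : ∀ {A B} → Enumeration A → Enumeration B → Enumeration (A × B)
enum-× EA EB = record
  { enum       = λ n → enum EA (proj₁ (unpair n)) , enum EB (proj₂ (unpair n))
  ; index      = λ { (x , y) → pair (index EA x) (index EB y) }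
  ; enum-index = λ { (x , y) → enum-pair x y }
  }
  where
  enum-pair : ∀ x y → (enum EA (proj₁ (unpair (pair (index EA x) (index EB y)))) ,
                       enum EB (proj₂ (unpair (pair (index EA x) (index EB y))))) ≡ (x , y)
  enum-pair x y rewrite unpair-pair (index EA x) (index EB y)
                      | enum-index EA x | enum-index EB y = refl

enum-⊎ : ∀ {A B} → Enumeration A → Enumeration B → Enumeration (A ⊎ B)
enum-⊎ {A} {B} EA EB = record { enum = decode ∘ unpair ; index = code ; enum-index = decode-code }
  where
  decode : ℕ × ℕ → A ⊎ B
  decode (zero  , n) = inj₁ (enum EA n)
  decode (suc _ , n) = inj₂ (enum EB n)

  code : A ⊎ B → ℕ
  code (inj₁ x) = pair 0 (index EA x)
  code (inj₂ y) = pair 1 (index EB y)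

  decode-code : ∀ z → decode (unpair (code z)) ≡ z
  decode-code (inj₁ x) rewrite unpair-pair 0 (index EA x) = cong inj₁ (enum-index EA x)
  decode-code (inj₂ y) rewrite unpair-pair 1 (index EB y) = cong inj₂ (enum-index EB y)

enum-retract : ∀ {A B} → Enumeration A → (f : A → B) (g : B → A) →
               (∀ y → f (g y) ≡ y) → Enumeration B
enum-retract EA f g fg = record
  { enum       = f ∘ enum EA
  ; index      = index EA ∘ g
  ; enum-index = λ y → trans (cong f (enum-index EA (g y))) (fg y)
  }

-- lists are coded as  [] ↦ 0,  x ∷ xs ↦ suc (pair (index x) (code xs));
-- decoding recurses on a fuel bound, which the code itself provides
enum-List : ∀ {A} → Enumeration A → Enumeration (List A)
enum-List {A} EA = record
  { enum       = λ n → decode n n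
  ; index      = code
  ; enum-index = λ xs → decode-code xs ℕP.≤-refl
  }
  where
  code : List A → ℕ
  code []       = 0
  code (x ∷ xs) = suc (pair (index EA x) (code xs))

  decode : ℕ → ℕ → List A
  decode zero     _       = []
  decode (suc _)  zero    = []
  decode (suc f)  (suc n) = enum EA (proj₁ (unpair n)) ∷ decode f (proj₂ (unpair n))

  decode-code : ∀ xs {f} → code xs ≤ f → decode f (code xs) ≡ xs
  decode-code []       {zero}  _ = refl
  decode-code []       {suc f} _ = refl
  decode-code (x ∷ xs) {suc f} (s≤s le)
    rewrite unpair-pair (index EA x) (code xs) | enum-index EA x =
    cong (x ∷_) (decode-code xs (ℕP.≤-trans (pair-≥ (index EA x) (code xs)) le))

enum-ℕ : Enumeration ℕ
enum-ℕ = record { enum = λ n → n ; index = λ n → n ; enum-index = λ _ → refl }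

-- A decidable equivalence relation on an enumerable type with infinitely
-- many classes admits a transversal indexed by ℕ without repetition:
-- list, in increasing order, the canonical indices (the least index of
-- each class).
module Transversal {A : Set} {_~_ : A → A → Set} (~-equiv : IsEquivalence _~_)
                   (_~?_ : Decidable _~_) (E : Enumeration A)
                   (new-class : ∀ M → ∃ λ x → ∀ {k} → k < M → ¬ (enum E k ~ x)) where

  open IsEquivalence ~-equiv using ()
    renaming (sym to ~-sym; trans to ~-trans; reflexive to ~-reflexive)

  least-index : ∀ x → ∃ (Least (λ m → enum E m ~ x))
  least-index x = least-witness (λ m → enum E m ~? x) (~-reflexive (enum-index E x))

  Canonical : ℕ → Set
  Canonical m = ∀ {k} → k < m → ¬ (enum E k ~ enum E m)

  canonical? : U.Decidable Canonical
  canonical? m = ℕP.allUpTo? (λ k → ¬? (enum E k ~? enum E m)) m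

  least-index-canonical : ∀ {x m} → Least (λ m → enum E m ~ x) m → Canonical m
  least-index-canonical (m~x , below) k<m k~m = below k<m (~-trans k~m m~x)

  canonical-unique : ∀ {m m′} → Canonical m → Canonical m′ → enum E m ~ enum E m′ → m ≡ m′
  canonical-unique {m} {m′} cm cm′ m~m′ with ℕP.<-cmp m m′
  ... | tri< m<m′ _ _ = contradiction m~m′ (cm′ m<m′)
  ... | tri≈ _ m≡m′ _ = m≡m′
  ... | tri> _ _ m′<m = contradiction (~-sym m~m′) (cm m′<m)

  -- the least index of a class avoiding all indices below M is at least M
  canonical-unbounded : ∀ M → ∃ λ m → M ≤ m × Canonical m
  canonical-unbounded M with new-class M
  ... | x , new with least-index x
  ...   | m , least = m , ℕP.≮⇒≥ (λ m<M → new m<M (proj₁ least)) , least-index-canonical least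

  open IncreasingEnumeration canonical? canonical-unbounded

  rep : ℕ → A
  rep n = enum E (nth n)

  rep-injective : ∀ {a b} → rep a ~ rep b → a ≡ b
  rep-injective {a} {b} ra~rb = nth-injective (canonical-unique (nth-P a) (nth-P b) ra~rb)

  rep-surjective : ∀ x → ∃ λ n → rep n ~ x
  rep-surjective x with least-index x
  ... | m , least with nth-onto (least-index-canonical least)
  ...   | n , refl = n , proj₁ least

enum-ℤ : Enumeration ℤ
enum-ℤ = enum-retract (enum-⊎ enum-ℕ enum-ℕ) from-⊎ to-⊎ (λ { (+ n) → refl ; -[1+ n ] → refl })
  where
  from-⊎ : ℕ ⊎ ℕ → ℤ
  from-⊎ (inj₁ n) = + n
  from-⊎ (inj₂ n) = -[1+ n ]

  to-⊎ : ℤ → ℕ ⊎ ℕ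
  to-⊎ (+ n)    = inj₁ n
  to-⊎ -[1+ n ] = inj₂ n

enum-Gen : Enumeration Gen
enum-Gen = enum-retract (enum-⊎ enum-ℕ (enum-⊎ enum-ℕ enum-ℕ)) from-⊎ to-⊎
                        (λ { (α i) → refl ; (β i) → refl ; (γ i) → refl })
  where
  from-⊎ : ℕ ⊎ (ℕ ⊎ ℕ) → Gen
  from-⊎ (inj₁ i)        = α i
  from-⊎ (inj₂ (inj₁ i)) = β i
  from-⊎ (inj₂ (inj₂ i)) = γ i

  to-⊎ : Gen → ℕ ⊎ (ℕ ⊎ ℕ)
  to-⊎ (α i) = inj₁ i
  to-⊎ (β i) = inj₂ (inj₁ i)
  to-⊎ (γ i) = inj₂ (inj₂ i)

enum-H : Enumeration H
enum-H = enum-List (enum-× enum-ℤ enum-Gen)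

sup-below : (ℕ → ℕ) → ℕ → ℕ
sup-below f zero    = 0
sup-below f (suc M) = f M ⊔ sup-below f M

sup-below-≥ : ∀ f {k M} → k < M → f k ≤ sup-below f M
sup-below-≥ f {k} {suc M} (s≤s k≤M) with ℕP.m≤n⇒m<n∨m≡n k≤M
... | inj₁ k<M  = ℕP.≤-trans (sup-below-≥ f k<M) (ℕP.m≤n⊔m (f M) (sup-below f M))
... | inj₂ refl = ℕP.m≤m⊔n (f k) (sup-below f M)

n<m^n : ∀ {m} → 1 < m → ∀ n → n < m ^ n
n<m^n 1<m zero    = s≤s z≤n
n<m^n 1<m (suc n) = ℕP.≤-<-trans (n<m^n 1<m n) (ℕP.^-monoʳ-< _ 1<m (ℕP.n<1+n n))

module IntegerSearch where

  open import Data.Integer.Base using (-_; _*_; ∣_∣; 0ℤ)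
  import Data.Integer.Properties as ℤP

  search-box : {Q : ℤ → Set} → U.Decidable Q → ∀ N → Dec (∃ λ c → ∣ c ∣ ≤ N × Q c)
  search-box {Q} Q? N with ℕP.anyUpTo? (λ n → Q? (+ n) ⊎-dec Q? (- (+ n))) (suc N)
  ... | yes (n , s≤s n≤N , inj₁ Q+n) = yes (+ n , n≤N , Q+n)
  ... | yes (n , s≤s n≤N , inj₂ Q-n) =
    yes (- (+ n) , subst (_≤ N) (sym (ℤP.∣-i∣≡∣i∣ (+ n))) n≤N , Q-n)
  ... | no none = no λ
    { (+ n      , n≤N , Qc) → none (n     , s≤s n≤N , inj₁ Qc)
    ; (-[1+ n ] , n≤N , Qc) → none (suc n , s≤s n≤N , inj₂ Qc)
    }

  -- whether (a , b) is an integer multiple of (x , y) with x ≠ 0;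
  -- the multiplier c of  a = c x  satisfies ∣ c ∣ ≤ ∣ a ∣
  multiple? : ∀ x y → x ≢ 0ℤ → ∀ a b → Dec (∃ λ c → a ≡ c * x × b ≡ c * y)
  multiple? x y x≢0 a b with search-box (λ c → (a ℤP.≟ c * x) ×-dec (b ℤP.≟ c * y)) ∣ a ∣
  ... | yes (c , _ , a≡cx , b≡cy) = yes (c , a≡cx , b≡cy)
  ... | no none = no λ { (c , a≡cx , b≡cy) → none (c , bound c a≡cx , a≡cx , b≡cy) }
    where
    bound : ∀ c → a ≡ c * x → ∣ c ∣ ≤ ∣ a ∣
    bound c refl = subst (∣ c ∣ ≤_) (sym (ℤP.abs-* c x))
                     (ℕP.m≤m*n ∣ c ∣ ∣ x ∣ {{ℕ.≢-nonZero (x≢0 ∘ ℤP.∣i∣≡0⇒i≡0)}})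

open IntegerSearch using (multiple?)

-- Monotonicity of ψs makes the stage of a relation at index i
-- unique, and p i > 1 bounds that stage by the size of a coefficient.
module RelationSubgroup (p q : ℕ → ℕ) (ψs : Stages) (mono : Monotone ψs)
                        (p>1 : ∀ i → 1 < p i) where

  open import Data.Integer.Base using (0ℤ; 1ℤ; _+_; _*_; -_; _-_; ∣_∣)
  import Data.Integer.Properties as ℤP
  open import Data.Integer.Tactic.RingSolver using (solve-∀)
  open import Data.Maybe.Base using (just; nothing)
  import Data.Maybe.Properties as MaybeP
  import Data.Bool.Properties as BoolP
  open import Data.List.Base using (map)
  open import Data.Product.Base using (map₁)
  open import Relation.Binary.PropositionalEquality using (cong₂; subst₂)
  open ≡-Reasoning

  scale-pair : ∀ c a b x y → (c * a) * x + ((c * b) * y + 0ℤ) ≡ c * (a * x + b * y)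
  scale-pair = solve-∀

  unit-pair : ∀ a b → a * 1ℤ + b * 0ℤ ≡ a
  unit-pair = solve-∀

  unit-pair′ : ∀ a b → a * 0ℤ + b * 1ℤ ≡ b
  unit-pair′ = solve-∀

  null-pair : ∀ a b → a * 0ℤ + b * 0ℤ ≡ 0ℤ
  null-pair = solve-∀

  absorb : ∀ c y → c * 0ℤ + y ≡ y
  absorb = solve-∀

  scale-pairAt : ∀ c a b x y → (c * a) * x + (c * b) * y ≡ c * (a * x + b * y)
  scale-pairAt = solve-∀

  level : Gen → ℕ
  level (α i) = i
  level (β i) = i
  level (γ i) = i

  δ-same : ∀ g → δ g g ≡ 1ℤ
  δ-same (α i) rewrite ℕP.≟-diag (refl {x = i}) = refl
  δ-same (β i) rewrite ℕP.≟-diag (refl {x = i}) = refl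
  δ-same (γ i) rewrite ℕP.≟-diag (refl {x = i}) = refl

  δ-apart : ∀ h g → level h ≢ level g → δ h g ≡ 0ℤ
  δ-apart (α i) (α j) i≢j with i ℕP.≟ j
  ... | yes i≡j = contradiction i≡j i≢j
  ... | no  _   = refl
  δ-apart (β i) (β j) i≢j with i ℕP.≟ j
  ... | yes i≡j = contradiction i≡j i≢j
  ... | no  _   = refl
  δ-apart (γ i) (γ j) i≢j with i ℕP.≟ j
  ... | yes i≡j = contradiction i≡j i≢j
  ... | no  _   = refl
  δ-apart (α _) (β _) _ = refl
  δ-apart (α _) (γ _) _ = refl
  δ-apart (β _) (α _) _ = refl
  δ-apart (β _) (γ _) _ = refl
  δ-apart (γ _) (α _) _ = refl
  δ-apart (γ _) (β _) _ = refl

  support : H → ℕ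
  support []            = 0
  support ((_ , h) ∷ x) = suc (level h) ⊔ support x

  coeff-beyond : ∀ x g → support x ≤ level g → coeff x g ≡ 0ℤ
  coeff-beyond []            g _  = refl
  coeff-beyond ((c , h) ∷ x) g le = begin
    c * δ h g + coeff x g  ≡⟨ cong₂ (λ d r → c * d + r) (δ-apart h g (ℕP.<⇒≢ h<g)) (coeff-beyond x g x≤g) ⟩
    c * 0ℤ + 0ℤ            ≡⟨ absorb c 0ℤ ⟩
    0ℤ                     ∎
    where
    h<g = ℕP.≤-trans (ℕP.m≤m⊔n (suc (level h)) (support x)) le
    x≤g = ℕP.≤-trans (ℕP.m≤n⊔m (suc (level h)) (support x)) le

  coeff-++ : ∀ x y g → coeff (x ++ y) g ≡ coeff x g + coeff y g
  coeff-++ []            y g = sym (ℤP.+-identityˡ _)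
  coeff-++ ((c , h) ∷ x) y g = begin
    c * δ h g + coeff (x ++ y) g          ≡⟨ cong (_+_ (c * δ h g)) (coeff-++ x y g) ⟩
    c * δ h g + (coeff x g + coeff y g)   ≡⟨ ℤP.+-assoc (c * δ h g) (coeff x g) (coeff y g) ⟨
    c * δ h g + coeff x g + coeff y g     ∎

  rα : ℕ → ℕ → ℤ
  rα i t = + (p i ^ t)

  rβ : ℕ → ℕ → Bool → ℤ
  rβ i t false = - (+ (q i ^ t))
  rβ i t true  = + (q i ^ t)

  pairAt : ℕ → ℤ → ℤ → Gen → ℤ
  pairAt i a b g = a * δ (α i) g + b * δ (β i) g

  pairAt-α : ∀ i a b → pairAt i a b (α i) ≡ a
  pairAt-α i a b = trans (cong (λ d → a * d + b * 0ℤ) (δ-same (α i))) (unit-pair a b)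

  pairAt-β : ∀ i a b → pairAt i a b (β i) ≡ b
  pairAt-β i a b = trans (cong (λ d → a * 0ℤ + b * d) (δ-same (β i))) (unit-pair′ a b)

  pairAt-γ : ∀ i a b k → pairAt i a b (γ k) ≡ 0ℤ
  pairAt-γ i a b k = null-pair a b

  pairAt-apart : ∀ i a b g → i ≢ level g → pairAt i a b g ≡ 0ℤ
  pairAt-apart i a b g i≢g =
    trans (cong₂ (λ d d′ → a * d + b * d′) (δ-apart (α i) g i≢g) (δ-apart (β i) g i≢g))
          (null-pair a b)

  relatorAt : ℕ → ℕ → Bool → Gen → ℤ
  relatorAt i t e = pairAt i (rα i t) (rβ i t e)

  Cb : List (ℤ × RelIx ψs) → Gen → ℤ
  Cb L g = coeff (combo p q ψs L) g

  combo-cons : ∀ c i t e cv L → combo p q ψs ((c , relIx i t e cv) ∷ L) ≡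
               (c * rα i t , α i) ∷ (c * rβ i t e , β i) ∷ combo p q ψs L
  combo-cons c i t false cv L = refl
  combo-cons c i t true  cv L = refl

  Cb-cons : ∀ c i t e cv L g →
    Cb ((c , relIx i t e cv) ∷ L) g ≡ c * relatorAt i t e g + Cb L g
  Cb-cons c i t e cv L g = begin
    Cb ((c , relIx i t e cv) ∷ L) g             ≡⟨ cong (λ z → coeff z g) (combo-cons c i t e cv L) ⟩
    coeff (scaled ++ combo p q ψs L) g           ≡⟨ coeff-++ scaled (combo p q ψs L) g ⟩
    coeff scaled g + Cb L g                      ≡⟨ cong (_+ Cb L g) (scale-pair c a b x y) ⟩
    c * pairAt i a b g + Cb L g                  ∎
    where
    a = rα i t
    b = rβ i t e
    x = δ (α i) g
    y = δ (β i) g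
    scaled : H
    scaled = (c * a , α i) ∷ (c * b , β i) ∷ []

  Cb-++ : ∀ L L′ g → Cb (L ++ L′) g ≡ Cb L g + Cb L′ g
  Cb-++ []                         L′ g = sym (ℤP.+-identityˡ _)
  Cb-++ ((c , relIx i t e cv) ∷ L) L′ g = begin
    Cb ((c , relIx i t e cv) ∷ L ++ L′) g  ≡⟨ Cb-cons c i t e cv (L ++ L′) g ⟩
    X + Cb (L ++ L′) g                     ≡⟨ cong (_+_ X) (Cb-++ L L′ g) ⟩
    X + (Cb L g + Cb L′ g)                 ≡⟨ ℤP.+-assoc X _ _ ⟨
    X + Cb L g + Cb L′ g                   ≡⟨ cong (_+ Cb L′ g) (Cb-cons c i t e cv L g) ⟨
    Cb ((c , relIx i t e cv) ∷ L) g + Cb L′ g ∎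
    where X = c * relatorAt i t e g

  negated : List (ℤ × RelIx ψs) → List (ℤ × RelIx ψs)
  negated = map (map₁ (λ c → - c))

  Cb-neg : ∀ L g → Cb (negated L) g ≡ - Cb L g
  Cb-neg []                         g = refl
  Cb-neg ((c , relIx i t e cv) ∷ L) g = begin
    Cb ((- c , relIx i t e cv) ∷ negated L) g ≡⟨ Cb-cons (- c) i t e cv (negated L) g ⟩
    - c * X + Cb (negated L) g                ≡⟨ cong (_+_ (- c * X)) (Cb-neg L g) ⟩
    - c * X + - Cb L g                        ≡⟨ negate c X (Cb L g) ⟩
    - (c * X + Cb L g)                        ≡⟨ cong (λ r → - r) (Cb-cons c i t e cv L g) ⟨
    - Cb ((c , relIx i t e cv) ∷ L) g         ∎
    where
    X = relatorAt i t e g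
    negate : ∀ c x y → - c * x + - y ≡ - (c * x + y)
    negate = solve-∀

  Span : (Gen → ℤ) → Set
  Span D = ∃ λ L → ∀ g → D g ≡ Cb L g

  span-resp : ∀ {D D′} → (∀ g → D g ≡ D′ g) → Span D → Span D′
  span-resp D≡D′ (L , D≡L) = L , λ g → trans (sym (D≡D′ g)) (D≡L g)

  span-zero : Span (λ _ → 0ℤ)
  span-zero = [] , λ _ → refl

  span-neg : ∀ {D} → Span D → Span (λ g → - D g)
  span-neg (L , D≡L) = negated L , λ g → trans (cong (λ r → - r) (D≡L g)) (sym (Cb-neg L g))

  span-+ : ∀ {D D′} → Span D → Span D′ → Span (λ g → D g + D′ g)
  span-+ (L , D≡L) (L′ , D′≡L′) =
    L ++ L′ , λ g → trans (cong₂ _+_ (D≡L g) (D′≡L′ g)) (sym (Cb-++ L L′ g))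

  EqHR-equivalence : IsEquivalence (EqHR p q ψs)
  EqHR-equivalence = record
    { refl  = λ {x} → span-resp (λ g → sym (ℤP.+-inverseʳ (coeff x g))) span-zero
    ; sym   = λ {x} {y} x~y → span-resp (λ g → swap (coeff x g) (coeff y g)) (span-neg x~y)
    ; trans = λ {x} {y} {z} x~y y~z →
                span-resp (λ g → chain (coeff x g) (coeff y g) (coeff z g)) (span-+ x~y y~z)
    }
    where
    swap : ∀ a b → - (a - b) ≡ b - a
    swap = solve-∀
    chain : ∀ a b c → (a - b) + (b - c) ≡ a - c
    chain = solve-∀

  stays-converged : ∀ {s i e} → ψs s i ≡ just e → ∀ {s′} → s ≤ s′ → ψs s′ i ≡ just e
  stays-converged conv {zero}   z≤n = conv
  stays-converged conv {suc s′} s≤ with ℕP.m≤n⇒m<n∨m≡n s≤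
  ... | inj₁ (s≤s s≤s′) = mono s′ _ _ (stays-converged conv s≤s′)
  ... | inj₂ refl       = conv

  conv-value : ∀ {i t e} → ConvAt ψs i t e → ψs t i ≡ just e
  conv-value {t = zero}  conv       = conv
  conv-value {t = suc t} (conv , _) = conv

  not-before : ∀ {i t t′ e e′} → ConvAt ψs i t′ e′ → t < t′ → ¬ ConvAt ψs i t e
  not-before {t′ = suc _} (_ , diverged) (s≤s t≤) cv
    with trans (sym diverged) (stays-converged (conv-value cv) t≤)
  ... | ()

  conv-unique : ∀ {i t t′ e e′} → ConvAt ψs i t e → ConvAt ψs i t′ e′ → t ≡ t′ × e ≡ e′
  conv-unique {t = t} {t′} cv cv′ with ℕP.<-cmp t t′
  ... | tri< t<t′ _ _ = contradiction cv (not-before cv′ t<t′)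
  ... | tri> _ _ t′<t = contradiction cv′ (not-before cv t′<t)
  ... | tri≈ _ refl _ = refl , MaybeP.just-injective (trans (sym (conv-value cv)) (conv-value cv′))

  RelatorMultiple : ℕ → ℕ → Bool → ℤ → ℤ → Set
  RelatorMultiple i t e a b = ∃ λ c → a ≡ c * rα i t × b ≡ c * rβ i t e

  Multiple : ℕ → ℤ → ℤ → Set
  Multiple i a b = Σ ℕ λ t → Σ Bool λ e → ConvAt ψs i t e × RelatorMultiple i t e a b

  Local : ℕ → ℤ → ℤ → Set
  Local i a b = (a ≡ 0ℤ × b ≡ 0ℤ) ⊎ Multiple i a b

  local-add : ∀ {i t e a b} c → ConvAt ψs i t e → Local i a b →
              Local i (c * rα i t + a) (c * rβ i t e + b)
  local-add c cv (inj₁ (refl , refl)) = inj₂ (_ , _ , cv , c , ℤP.+-identityʳ _ , ℤP.+-identityʳ _)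
  local-add c cv (inj₂ (t′ , e′ , cv′ , c′ , refl , refl)) with conv-unique cv cv′
  ... | refl , refl =
    inj₂ (t′ , e′ , cv , c + c′ , sym (ℤP.*-distribʳ-+ _ c c′) , sym (ℤP.*-distribʳ-+ _ c c′))

  Cb-γ : ∀ L k → Cb L (γ k) ≡ 0ℤ
  Cb-γ []                         k = refl
  Cb-γ ((c , relIx i t e cv) ∷ L) k = begin
    Cb ((c , relIx i t e cv) ∷ L) (γ k)      ≡⟨ Cb-cons c i t e cv L (γ k) ⟩
    c * relatorAt i t e (γ k) + Cb L (γ k)   ≡⟨ cong₂ (λ d r → c * d + r)
                                                      (pairAt-γ i (rα i t) (rβ i t e) k) (Cb-γ L k) ⟩
    c * 0ℤ + 0ℤ                              ≡⟨ absorb c 0ℤ ⟩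
    0ℤ                                       ∎

  Cb-local : ∀ L i → Local i (Cb L (α i)) (Cb L (β i))
  Cb-local []                         i = inj₁ (refl , refl)
  Cb-local ((c , relIx j t e cv) ∷ L) i =
    subst₂ (Local i) (sym (Cb-cons c j t e cv L (α i))) (sym (Cb-cons c j t e cv L (β i)))
                     (add (j ℕP.≟ i))
    where
    R = relatorAt j t e
    add : Dec (j ≡ i) → Local i (c * R (α i) + Cb L (α i)) (c * R (β i) + Cb L (β i))
    add (yes refl) = subst₂ (Local i) (cong (λ d → c * d + Cb L (α i)) (sym (pairAt-α i (rα i t) (rβ i t e))))
                                      (cong (λ d → c * d + Cb L (β i)) (sym (pairAt-β i (rα i t) (rβ i t e))))
                                      (local-add c cv (Cb-local L i))
    add (no j≢i)   = subst₂ (Local i) (sym (unaffected (α i) refl)) (sym (unaffected (β i) refl))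
                                      (Cb-local L i)
      where
      unaffected : ∀ g → level g ≡ i → c * R g + Cb L g ≡ Cb L g
      unaffected g refl = trans (cong (λ d → c * d + Cb L g) (pairAt-apart j (rα j t) (rβ j t e) g j≢i))
                                (absorb c (Cb L g))

  span-γ : ∀ {D} → Span D → ∀ k → D (γ k) ≡ 0ℤ
  span-γ (L , D≡L) k = trans (D≡L (γ k)) (Cb-γ L k)

  span-local : ∀ {D} → Span D → ∀ i → Local i (D (α i)) (D (β i))
  span-local (L , D≡L) i = subst₂ (Local i) (sym (D≡L (α i))) (sym (D≡L (β i))) (Cb-local L i)

  span-pairAt : ∀ {i a b} → Local i a b → Span (pairAt i a b)
  span-pairAt {i} (inj₁ (refl , refl)) =
    span-resp (λ g → sym (cong₂ _+_ (ℤP.*-zeroˡ (δ (α i) g)) (ℤP.*-zeroˡ (δ (β i) g)))) span-zero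
  span-pairAt {i} (inj₂ (t , e , cv , c , refl , refl)) = (c , relIx i t e cv) ∷ [] , λ g →
    sym (trans (Cb-cons c i t e cv [] g)
               (trans (ℤP.+-identityʳ _) (sym (scale-pairAt c (rα i t) (rβ i t e) (δ (α i) g) (δ (β i) g)))))

  SupportedBelow : ℕ → (Gen → ℤ) → Set
  SupportedBelow N D = ∀ g → N ≤ level g → D g ≡ 0ℤ

  -- A finitely supported D without γ-coefficients and with local pairs lies
  -- in the subgroup: peel off the pair at the top level N, by induction on N.
  span-from-local : ∀ N {D} → (∀ k → D (γ k) ≡ 0ℤ) →
                    (∀ {i} → i < N → Local i (D (α i)) (D (β i))) → SupportedBelow N D → Span D
  span-from-local zero    {D} _    _     vanish = span-resp (λ g → sym (vanish g z≤n)) span-zero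
  span-from-local (suc N) {D} no-γ local vanish =
    span-resp (λ g → cancel (D g) (top g))
              (span-+ (span-from-local N no-γ′ local′ vanish′) (span-pairAt (local (ℕP.n<1+n N))))
    where
    top : Gen → ℤ
    top = pairAt N (D (α N)) (D (β N))

    rest : Gen → ℤ
    rest g = D g - top g

    cancel : ∀ x y → (x - y) + y ≡ x
    cancel = solve-∀

    no-γ′ : ∀ k → rest (γ k) ≡ 0ℤ
    no-γ′ k = cong₂ _-_ (no-γ k) (pairAt-γ N (D (α N)) (D (β N)) k)

    unchanged : ∀ g → N ≢ level g → rest g ≡ D g
    unchanged g N≢g = trans (cong (λ r → D g - r) (pairAt-apart N (D (α N)) (D (β N)) g N≢g))
                            (ℤP.+-identityʳ (D g))

    local′ : ∀ {i} → i < N → Local i (rest (α i)) (rest (β i))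
    local′ {i} i<N = subst₂ (Local i) (sym (unchanged (α i) (ℕP.>⇒≢ i<N)))
                                      (sym (unchanged (β i) (ℕP.>⇒≢ i<N)))
                                      (local (ℕP.m<n⇒m<1+n i<N))

    at-top : ∀ g → N ≡ level g → rest g ≡ 0ℤ
    at-top (α N) refl = trans (cong (λ r → D (α N) - r) (pairAt-α N (D (α N)) (D (β N))))
                              (ℤP.+-inverseʳ (D (α N)))
    at-top (β N) refl = trans (cong (λ r → D (β N) - r) (pairAt-β N (D (α N)) (D (β N))))
                              (ℤP.+-inverseʳ (D (β N)))
    at-top (γ N) refl = no-γ′ N

    vanish′ : SupportedBelow N rest
    vanish′ g N≤g with ℕP.m≤n⇒m<n∨m≡n N≤g
    ... | inj₁ N<g = cong₂ _-_ (vanish g N<g) (pairAt-apart N (D (α N)) (D (β N)) g (ℕP.<⇒≢ N<g))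
    ... | inj₂ N≡g = at-top g N≡g

  -- deciding whether a pair is local: a nonzero multiple c of the relator
  -- at stage t has  t < p i ^ t ≤ ∣ c ∣ p i ^ t = ∣ a ∣
  conv? : ∀ i t e → Dec (ConvAt ψs i t e)
  conv? i zero    e = MaybeP.≡-dec BoolP._≟_ (ψs zero i) (just e)
  conv? i (suc t) e = MaybeP.≡-dec BoolP._≟_ (ψs (suc t) i) (just e)
                ×-dec MaybeP.≡-dec BoolP._≟_ (ψs t i) nothing

  rα≢0 : ∀ i t → rα i t ≢ 0ℤ
  rα≢0 i t eq = ℕP.<⇒≢ (ℕP.≤-<-trans z≤n (n<m^n (p>1 i) t)) (sym (ℤP.+-injective eq))

  stage-bound : ∀ {i t e a b} → ¬ (a ≡ 0ℤ × b ≡ 0ℤ) → RelatorMultiple i t e a b → t < ∣ a ∣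
  stage-bound {i} {t} {e} nonzero (c , refl , refl) with c ℤP.≟ 0ℤ
  ... | yes refl = contradiction (ℤP.*-zeroˡ (rα i t) , ℤP.*-zeroˡ (rβ i t e)) nonzero
  ... | no c≢0   = subst (t <_) (sym (ℤP.abs-* c (rα i t)))
                     (ℕP.<-≤-trans (n<m^n (p>1 i) t)
                                   (ℕP.m≤n*m (p i ^ t) ∣ c ∣ {{ℕ.≢-nonZero (c≢0 ∘ ℤP.∣i∣≡0⇒i≡0)}}))

  at-stage? : ∀ i a b t → Dec (Σ Bool λ e → ConvAt ψs i t e × RelatorMultiple i t e a b)
  at-stage? i a b t = ∃-Bool? (with-value false) (with-value true)
    where
    with-value : ∀ e → Dec (ConvAt ψs i t e × RelatorMultiple i t e a b)
    with-value e = conv? i t e ×-dec multiple? (rα i t) (rβ i t e) (rα≢0 i t) a b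

  local? : ∀ i a b → Dec (Local i a b)
  local? i a b with (a ℤP.≟ 0ℤ) ×-dec (b ℤP.≟ 0ℤ)
  ... | yes zeros  = yes (inj₁ zeros)
  ... | no nonzero with ℕP.anyUpTo? (at-stage? i a b) ∣ a ∣
  ...   | yes (t , _ , e , cv , m) = yes (inj₂ (t , e , cv , m))
  ...   | no none = no λ
          { (inj₁ zeros) → nonzero zeros
          ; (inj₂ (t , e , cv , m)) → none (t , stage-bound {e = e} nonzero m , e , cv , m)
          }

  span? : ∀ N {D} → SupportedBelow N D → Dec (Span D)
  span? N {D} vanish with ℕP.allUpTo? (λ k → D (γ k) ℤP.≟ 0ℤ) N
                        | ℕP.allUpTo? (λ i → local? i (D (α i)) (D (β i))) N
  ... | no γ≢0    | _         = no λ s → γ≢0 (λ {k} _ → span-γ s k)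
  ... | yes _     | no ¬local = no λ s → ¬local (λ {i} _ → span-local s i)
  ... | yes γ<N=0 | yes local = yes (span-from-local N no-γ local vanish)
    where
    no-γ : ∀ k → D (γ k) ≡ 0ℤ
    no-γ k with k ℕP.<? N
    ... | yes k<N = γ<N=0 k<N
    ... | no  k≮N = vanish (γ k) (ℕP.≮⇒≥ k≮N)

  EqHR? : Decidable (EqHR p q ψs)
  EqHR? x y = span? (support x ⊔ support y) λ g le →
    cong₂ _-_ (coeff-beyond x g (ℕP.≤-trans (ℕP.m≤m⊔n (support x) (support y)) le))
              (coeff-beyond y g (ℕP.≤-trans (ℕP.m≤n⊔m (support x) (support y)) le))

  -- 𝓗/𝓡 has infinitely many classes: a generator γ B of level beyond the
  -- supports of finitely many elements is equivalent to none of them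
  new-class : ∀ (xs : ℕ → H) M → ∃ λ x → ∀ {k} → k < M → ¬ EqHR p q ψs (xs k) x
  new-class xs M = x , distinct
    where
    B = sup-below (support ∘ xs) M
    x = (1ℤ , γ B) ∷ []

    x-at-B : coeff x (γ B) ≡ 1ℤ
    x-at-B = cong (λ d → 1ℤ * d + 0ℤ) (δ-same (γ B))

    distinct : ∀ {k} → k < M → ¬ EqHR p q ψs (xs k) x
    distinct {k} k<M xk~x with begin
        0ℤ - 1ℤ                          ≡⟨ cong₂ _-_ (coeff-beyond (xs k) (γ B) (sup-below-≥ (support ∘ xs) k<M))
                                                      x-at-B ⟨
        coeff (xs k) (γ B) - coeff x (γ B) ≡⟨ span-γ xk~x B ⟩
        0ℤ                               ∎
    ... | ()

prime>1 : ∀ {n} → Prime n → 1 < n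
prime>1 pn = ℕ.nonTrivial⇒n>1 _ {{prime⇒nonTrivial pn}}

lemma3p1 : (p q r : ℕ → ℕ) → OddPrimePartition p q r →
    (ψs : Stages) → Monotone ψs → ComputablePresentation p q ψs
lemma3p1 p q r partition ψs mono = record
  { _⊕_  = λ a b → proj₁ (rep-surjective (rep a +H rep b))
  ; h    = rep
  ; hom  = λ a b → proj₂ (rep-surjective (rep a +H rep b))
  ; inj  = λ _ _ → rep-injective
  ; surj = rep-surjective
  }
  where
  p>1 : ∀ i → 1 < p i
  p>1 i = prime>1 (OddPrimePartition.prime partition Fin.zero i)

  open RelationSubgroup p q ψs mono p>1
  open Transversal EqHR-equivalence EqHR? enum-H (new-class (enum enum-H))
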